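{- Let $x\in\{0,1\}^{\mathbb{Z}^2}$ be strongly recurrent. Then $x$ is doubly periodic if and only if $\sup_{k\geq1}p_x^{*\mathrm{ab}}(k)<\infty$.
   Context: For a finite set $S\subset\mathbb{Z}^2$ and $t\in\mathbb{Z}^2$, the $S$-factor of $x$ at $t$ is $x[t+S]=(x(t+s))_{s\in S}$. Two $S$-factors are Abelian equivalent if each letter occurs the same number of times in both. Let $p_x^{\mathrm{ab}}(S)$ be the number of Abelian equivalence classes of $S$-factors of $x$ (over all $t\in\mathbb{Z}^2$), and $p_x^{*\mathrm{ab}}(k)=\sup\{p_x^{\mathrm{ab}}(S): S\subset\mathbb{Z}^2,\ \#S=k\}$ for $k\ge 1$. $x$ is doubly periodic if there are two linearly independent vectors $p\in\mathbb{Z}^2$ with $x(t+p)=x(t)$ for all $t\in\mathbb{Z}^2$. $\mathbb{P}^1(\mathbb{R})$ is the set of lines through $0$ in $\mathbb{R}^2$; $\operatorname{dir}(q)=\mathbb{R}q$ for $q\neq0$; identifying $\mathbb{P}^1(\mathbb{R})$ with $\mathbb{R}/\pi\mathbb{Z}$ by angle, $d_\pi([\theta],[\phi])=\min_{m\in\mathbb{Z}}|\theta-\phi-m\pi|$. Let $\Sigma_N=[-N,N]^2\cap\mathbb{Z}^2$. $x$ is strongly recurrent if there is $\delta>0$ such that for every $N\geq1$ there are nonzero $u_N,v_N\in\mathbb{Z}^2$ with $x(z+u_N)=x(z)=x(z+v_N)$ for all $z\in\Sigma_N$ and $d_\pi(\operatorname{dir}(u_N),\operatorname{dir}(v_N))\geq\delta$.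 -}

module Defs where

open import Data.Fin.Base using (Fin)
open import Data.Fin.Properties using (_≟_)
open import Data.Integer.Base as ℤ using (ℤ; +_; 0ℤ)
open import Data.List.Base using (List; length; map; filter)
open import Data.List.Relation.Unary.Unique.Propositional using (Unique)
open import Data.Nat.Base as ℕ using (ℕ; zero; suc; _!)
open import Data.Nat.Properties using (_!≢0)
open import Data.Product.Base using (∃-syntax; Σ-syntax; _×_; _,_)
open import Data.Rational.Base as ℚ using (ℚ; 0ℚ; 1ℚ)
open import Function.Definitions using (Injective)
open import Relation.Binary.Core using (Rel)
open import Relation.Binary.PropositionalEquality.Core using (_≡_; _≢_)
open import Level using (0ℓ)

------------------------------------------------------------------------
-- Real numbers
--
-- A real number is a Cauchy sequence of rationals, taken up to _≃_.
-- Operations and relations are defined on all rational sequences; the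
-- operations send Cauchy sequences to Cauchy sequences, and the named
-- constants are Cauchy, but that is not recorded in their types.

Seq : Set
Seq = ℕ → ℚ

IsCauchy : Seq → Set
IsCauchy a = ∀ ε → 0ℚ ℚ.< ε →
  ∃[ N ] (∀ m n → N ℕ.≤ m → N ℕ.≤ n → ℚ.∣ a m ℚ.- a n ∣ ℚ.< ε)

record ℝ : Set where
  constructor real
  field
    seq    : Seq
    cauchy : IsCauchy seq

open ℝ public

infix 4 _≤ʳ_ _≃_
infixl 6 _-ʳ_
infixl 7 _*ʳ_

_≤ʳ_ : Rel Seq 0ℓ
a ≤ʳ b = ∀ ε → 0ℚ ℚ.< ε → ∃[ N ] (∀ n → N ℕ.≤ n → a n ℚ.≤ b n ℚ.+ ε)

_≃_ : Rel Seq 0ℓ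
a ≃ b = a ≤ʳ b × b ≤ʳ a

-- Eventually bounded below by a positive rational; being positive at
-- every index would also hold of sequences converging to 0.
Positive : Seq → Set
Positive a = Σ[ ε ∈ ℚ ] (0ℚ ℚ.< ε × ∃[ N ] (∀ n → N ℕ.≤ n → ε ℚ.≤ a n))

_-ʳ_ : Seq → Seq → Seq
(a -ʳ b) n = a n ℚ.- b n

_*ʳ_ : Seq → Seq → Seq
(a *ʳ b) n = a n ℚ.* b n

∣_∣ʳ : Seq → Seq
∣ a ∣ʳ n = ℚ.∣ a n ∣

fromℤ : ℤ → Seq
fromℤ i _ = i ℚ./ 1

infixr 8 _^_

_^_ : ℚ → ℕ → ℚ
q ^ zero  = 1ℚ
q ^ suc n = q ℚ.* q ^ n

-- ∑≤ n f = f 0 + … + f n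
∑≤ : ℕ → (ℕ → ℚ) → ℚ
∑≤ zero    f = f zero
∑≤ (suc n) f = ∑≤ n f ℚ.+ f (suc n)

1/[_]! : ℕ → ℚ
1/[ n ]! = ℚ._/_ (+ 1) (n !) {{n !≢0}}

-- The n-th approximation is the n-th partial sum of the power series at
-- the n-th approximation of the argument.
cos : Seq → Seq
cos θ n = ∑≤ n (λ k → (ℚ.- 1ℚ) ^ k ℚ.* 1/[ 2 ℕ.* k ]! ℚ.* θ n ^ (2 ℕ.* k))

sin : Seq → Seq
sin θ n = ∑≤ n (λ k → (ℚ.- 1ℚ) ^ k ℚ.* 1/[ suc (2 ℕ.* k) ]! ℚ.* θ n ^ suc (2 ℕ.* k))

-- The Leibniz series π = 4 (1 - 1/3 + 1/5 - …).
π : Seq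
π n = (+ 4 ℚ./ 1) ℚ.* ∑≤ n (λ k → (ℚ.- 1ℚ) ^ k ℚ.* (+ 1 ℚ./ suc (2 ℕ.* k)))

------------------------------------------------------------------------
-- The lattice ℤ² and directions

ℤ² : Set
ℤ² = ℤ × ℤ

0² : ℤ²
0² = 0ℤ , 0ℤ

infixl 6 _+²_
infixl 7 _·²_

_+²_ : ℤ² → ℤ² → ℤ²
(a , b) +² (c , d) = a ℤ.+ c , b ℤ.+ d

_·²_ : ℤ → ℤ² → ℤ²
n ·² (a , b) = n ℤ.* a , n ℤ.* b

-- For integer vectors, independence over ℤ and over ℝ coincide.
LinearlyIndependent : ℤ² → ℤ² → Set
LinearlyIndependent p q =
  ∀ m n → m ·² p +² n ·² q ≡ 0² → m ≡ 0ℤ × n ≡ 0ℤ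

-- (a , b) lies on the line dir(q) = ℝq.
_∈dir_ : Seq × Seq → ℤ² → Set
(a , b) ∈dir (q₁ , q₂) =
  Σ[ r ∈ ℝ ] (a ≃ seq r *ʳ fromℤ q₁ × b ≃ seq r *ʳ fromℤ q₂)

-- The line dir(q), for q ≢ 0², corresponds to the class of θ in ℝ/πℤ.
IsAngleOf : ℝ → ℤ² → Set
IsAngleOf θ q = (cos (seq θ) , sin (seq θ)) ∈dir q

-- δ ≤ d_π([θ], [φ]), where d_π([θ], [φ]) is the minimum over m ∈ ℤ of
-- |θ - φ - mπ|.
_≤dπ[_,_] : ℝ → ℝ → ℝ → Set
δ ≤dπ[ θ , φ ] =
  (m : ℤ) → seq δ ≤ʳ ∣ seq θ -ʳ seq φ -ʳ fromℤ m *ʳ π ∣ʳ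

-- δ ≤ d_π(dir(u), dir(v)). Angles of dir(u) and dir(v) exist and are
-- unique modulo π, so the choice of θ and φ is immaterial.
_≤dπ-dir[_,_] : ℝ → ℤ² → ℤ² → Set
δ ≤dπ-dir[ u , v ] =
  Σ[ θ ∈ ℝ ] Σ[ φ ∈ ℝ ] (IsAngleOf θ u × IsAngleOf φ v × δ ≤dπ[ θ , φ ])

------------------------------------------------------------------------
-- Cardinalities and suprema in ℕ ∪ {∞}

-- A value e ∈ ℕ ∪ {∞} is given by its set of upper bounds: e B means e ≤ B.
ℕ∞ : Set₁
ℕ∞ = ℕ → Set

Finite : ℕ∞ → Set
Finite e = ∃[ B ] e B

sup : {I : Set} → (I → ℕ∞) → ℕ∞
sup e B = ∀ i → e i B

-- The number of classes of an equivalence relation: the supremum of the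
-- sizes of families of pairwise inequivalent elements.
#classes : {A : Set} → Rel A 0ℓ → ℕ∞
#classes {A} _≈_ B = ∀ {n} (f : Fin n → A) → Injective _≡_ _≈_ f → n ℕ.≤ B

------------------------------------------------------------------------
-- Configurations

Config : Set
Config = ℤ² → Fin 2

record FiniteSubset : Set where
  constructor finiteSubset
  field
    elements : List ℤ²
    unique   : Unique elements

open FiniteSubset public

# : FiniteSubset → ℕ
# S = length (elements S)

-- x[t+S], listed in the order in which the elements of S are listed.
factor : Config → FiniteSubset → ℤ² → List (Fin 2)
factor x S t = map (λ s → x (t +² s)) (elements S)

occurrences : Fin 2 → List (Fin 2) → ℕ
occurrences a w = length (filter (a ≟_) w)

AbelianEquivalent : Rel (List (Fin 2)) 0ℓ
AbelianEquivalent v w = ∀ a → occurrences a v ≡ occurrences a w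

p-ab : Config → FiniteSubset → ℕ∞
p-ab x S = #classes (λ t t′ → AbelianEquivalent (factor x S t) (factor x S t′))

p*-ab : Config → ℕ → ℕ∞
p*-ab x k = sup {I = Σ[ S ∈ FiniteSubset ] # S ≡ k} (λ (S , _) → p-ab x S)

IsPeriod : Config → ℤ² → Set
IsPeriod x p = ∀ t → x (t +² p) ≡ x t

DoublyPeriodic : Config → Set
DoublyPeriodic x =
  ∃[ p ] ∃[ q ] (LinearlyIndependent p q × IsPeriod x p × IsPeriod x q)

-- z ∈ Σ_N = [-N, N]² ∩ ℤ²
_∈Box_ : ℤ² → ℕ → Set
(i , j) ∈Box N =
  (ℤ.- (+ N) ℤ.≤ i × i ℤ.≤ + N) × (ℤ.- (+ N) ℤ.≤ j × j ℤ.≤ + N)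

StronglyRecurrent : Config → Set
StronglyRecurrent x =
  Σ[ δ ∈ ℝ ] (Positive (seq δ) × (∀ N → 1 ℕ.≤ N →
    ∃[ u ] ∃[ v ] (u ≢ 0² × v ≢ 0²
      × (∀ z → z ∈Box N → x (z +² u) ≡ x z × x z ≡ x (z +² v))
      × δ ≤dπ-dir[ u , v ])))

{-# OPTIONS --safe #-}

-- Chaining the nonzero returns u_N gives arbitrarily many of them for any finite window, so any
-- list of points, repetitions allowed, can be replaced by distinct points carrying the same
-- letters as seen from finitely many given translates. Repeating the j-th point of S 2^j times
-- turns the number of ones in a factor into the binary code of its word; hence if the Abelian
-- complexity is bounded by B, then so is, for every S, the number of S-factors. Any B + 1
-- translates then contain two with equal S-factors. Conversely, the determinant D of two
-- independent periods gives the periods (D , 0) and (0 , D).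

module Submission where

open import Defs
open import Data.Nat.Base using (ℕ; _≤_)
open import Data.Product.Base using (Σ-syntax; _,_)
open import Function.Bundles using (_⇔_)

open import Data.Empty using (⊥-elim)
open import Data.Fin.Base as Fin using (Fin; zero; suc; toℕ; fromℕ<; combine)
import Data.Fin.Properties as Fin
open import Data.Integer.Base as ℤ using (ℤ; +_; -[1+_]; 0ℤ; 1ℤ)
import Data.Integer.DivMod as ℤ
import Data.Integer.Properties as ℤ
open import Data.Integer.Tactic.RingSolver using (solve-∀)
open import Data.List.Base
  using (List; []; _∷_; _++_; length; map; filter; lookup; tabulate; applyUpTo; cartesianProductWith)
open import Data.List.Membership.Propositional using (_∈_; _∉_; find)
open import Data.List.Membership.Propositional.Properties
  using (finite; ∈-lookup; ∈-map⁺; ∈-tabulate⁺; ∈-upTo⁺; ∈-cartesianProductWith⁺)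
open import Data.List.Membership.Setoid.Properties using (index-injective)
import Data.List.Properties as List
open import Data.List.Relation.Unary.All as All using (All; []; _∷_)
open import Data.List.Relation.Unary.All.Properties using (¬Any⇒All¬; map⁺; map⁻)
open import Data.List.Relation.Unary.AllPairs using ([]; _∷_)
open import Data.List.Relation.Unary.Any as Any using (here; there)
open import Data.List.Relation.Unary.Unique.Propositional using (Unique)
import Data.List.Relation.Unary.Unique.Propositional.Properties as Unique
open import Data.Nat.Base as ℕ using (zero; suc; z≤n; s≤s; _!)
open import Data.Nat.Divisibility using (_∣_; ∣-trans; m∣m*n; m≤n⇒m!∣n!)
import Data.Nat.Properties as ℕ
open import Data.Product.Base using (∃-syntax; _×_; proj₁; proj₂)
open import Data.Product.Properties using (≡-dec; ,-injective)
open import Function.Base using (_∘_; case_of_)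
open import Function.Bundles using (mk⇔; mk↣)
open import Function.Definitions using (Injective)
open import Relation.Binary.Definitions using (DecidableEquality; tri<; tri≈; tri>)
open import Relation.Binary.PropositionalEquality
  using (_≡_; _≢_; refl; sym; trans; cong; cong₂; subst; setoid; module ≡-Reasoning)
open import Relation.Nullary using (yes; no; contradiction; decidable-stable; _×-dec_)

open import Algebra.Properties.AbelianGroup ℤ.+-0-abelianGroup using (∙-cancelˡ)

-- Counting in lists without repetitions.

lookup-injective : {A : Set} {xs : List A} → Unique xs → Injective _≡_ _≡_ (lookup xs)
lookup-injective (_   ∷ _)  {zero}  {zero}  _  = refl
lookup-injective (x≢s ∷ _)  {zero}  {suc j} eq = contradiction eq (All.lookup x≢s (∈-lookup j))
lookup-injective (x≢s ∷ _)  {suc i} {zero}  eq = contradiction (sym eq) (All.lookup x≢s (∈-lookup i))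
lookup-injective (_   ∷ xs) {suc i} {suc j} eq = cong suc (lookup-injective xs eq)

-- Equal positions in `ys` carry equal entries, and `xs` repeats none, so sending an index of `xs`
-- to the position of its entry in `ys` is injective.
Unique-⊆⇒length≤ : {A : Set} {xs ys : List A} → Unique xs → All (_∈ ys) xs → length xs ≤ length ys
Unique-⊆⇒length≤ {A} {xs} {ys} xs! xs⊆ys = Fin.injective⇒≤ {f = λ i → Any.index (position i)}
  λ {i} {j} eq → lookup-injective xs! (index-injective (setoid A) (position i) (position j) eq)
  where
  position : ∀ i → lookup xs i ∈ ys
  position i = All.lookup xs⊆ys (∈-lookup i)

-- Translations of the lattice.

_≟²_ : DecidableEquality ℤ²
_≟²_ = ≡-dec ℤ._≟_ ℤ._≟_

open import Data.List.Membership.DecPropositional _≟²_ using (_∈?_; _∉?_)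

+²-assoc : ∀ u v w → (u +² v) +² w ≡ u +² (v +² w)
+²-assoc (a , b) (c , d) (e , f) = cong₂ _,_ (ℤ.+-assoc a c e) (ℤ.+-assoc b d f)

+²-identityʳ : ∀ u → u +² 0² ≡ u
+²-identityʳ (a , b) = cong₂ _,_ (ℤ.+-identityʳ a) (ℤ.+-identityʳ b)

+²-cancelˡ : ∀ u {v w} → u +² v ≡ u +² w → v ≡ w
+²-cancelˡ (a , b) {c , d} {e , f} eq with ,-injective eq
... | eq₁ , eq₂ = cong₂ _,_ (∙-cancelˡ a c e eq₁) (∙-cancelˡ b d f eq₂)

·²-zeroˡ : ∀ v → 0ℤ ·² v ≡ 0²
·²-zeroˡ (a , b) = refl

·²-suc : ∀ n v → ℤ.suc n ·² v ≡ n ·² v +² v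
·²-suc n (a , b) = cong₂ _,_ (eq n a) (eq n b)
  where
  eq : ∀ n a → ℤ.suc n ℤ.* a ≡ n ℤ.* a ℤ.+ a
  eq n a = trans (ℤ.suc-* n a) (ℤ.+-comm a (n ℤ.* a))

·²-injectiveˡ : ∀ {v} → v ≢ 0² → Injective _≡_ _≡_ (λ n → + n ·² v)
·²-injectiveˡ {a , b} v≢0 {m} {n} eq with a ℤ.≟ 0ℤ | b ℤ.≟ 0ℤ
... | no a≢0 | _ = ℤ.+-injective (ℤ.*-cancelʳ-≡ (+ m) (+ n) a {{ℤ.≢-nonZero a≢0}} (cong proj₁ eq))
... | yes _ | no b≢0 = ℤ.+-injective (ℤ.*-cancelʳ-≡ (+ m) (+ n) b {{ℤ.≢-nonZero b≢0}} (cong proj₂ eq))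
... | yes refl | yes refl = contradiction refl v≢0

-- Otherwise `ys` would be closed under adding `v` and contain the whole orbit `y + n v`, which is
-- infinite because `v ≢ 0²`.
leaves : ∀ {v} → v ≢ 0² → ∀ {y ys} → y ∈ ys → ∃[ z ] (z ∈ ys × z +² v ∉ ys)
leaves {v} v≢0 {y} {ys} y∈ys with Any.any? (λ z → z +² v ∉? ys) ys
... | yes some = find some
... | no none = ⊥-elim (finite (mk↣ {to = orbit} orbit-injective) ys orbit∈)
  where
  orbit : ℕ → ℤ²
  orbit n = y +² + n ·² v
  orbit-injective : Injective _≡_ _≡_ orbit
  orbit-injective eq = ·²-injectiveˡ v≢0 (+²-cancelˡ y eq)
  closed : ∀ {z} → z ∈ ys → z +² v ∈ ys
  closed {z} z∈ys with (z +² v) ∈? ys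
  ... | yes p = p
  ... | no ¬p = contradiction ¬p (All.lookup (¬Any⇒All¬ ys none) z∈ys)
  orbit∈ : ∀ n → orbit n ∈ ys
  orbit∈ zero = subst (_∈ ys) (sym (trans (cong (y +²_) (·²-zeroˡ v)) (+²-identityʳ y))) y∈ys
  orbit∈ (suc n) = subst (_∈ ys)
    (trans (+²-assoc y _ v) (cong (y +²_) (sym (·²-suc (+ n) v)))) (closed (orbit∈ n))

-- Enclosing finitely many points in a box.

boxed : ∀ i {N} → ℤ.∣ i ∣ ≤ N → ℤ.- (+ N) ℤ.≤ i × i ℤ.≤ + N
boxed (+ n)    n≤N        = ℤ.neg-≤-pos , ℤ.+≤+ n≤N
boxed -[1+ n ] (s≤s n≤N) = ℤ.-≤- n≤N , ℤ.-≤+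

norm : ℤ² → ℕ
norm (i , j) = ℤ.∣ i ∣ ℕ.+ ℤ.∣ j ∣

∈Box : ∀ z {N} → norm z ≤ N → z ∈Box N
∈Box (i , j) z≤N = boxed i (ℕ.≤-trans (ℕ.m≤m+n _ _) z≤N) , boxed j (ℕ.≤-trans (ℕ.m≤n+m _ _) z≤N)

bounded : ∀ zs → ∃[ N ] All (λ z → norm z ≤ N) zs
bounded [] = 0 , []
bounded (z ∷ zs) with bounded zs
... | N , zs≤N = norm z ℕ.+ N , ℕ.m≤m+n _ _ ∷ All.map (λ p → ℕ.≤-trans p (ℕ.m≤n+m _ _)) zs≤N

-- Binary coding of words by repeated points.

weighted : List ℤ² → List ℤ²
weighted [] = []
weighted (s ∷ ss) = s ∷ weighted ss ++ weighted ss

ones : List (Fin 2) → ℕ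
ones = occurrences (suc zero)

ones-++ : ∀ v w → ones (v ++ w) ≡ ones v ℕ.+ ones w
ones-++ v w = trans (cong length (List.filter-++ (suc zero Fin.≟_) v w))
  (List.length-++ (filter (suc zero Fin.≟_) v))

ones-weighted : (f : ℤ² → Fin 2) → ∀ s ss →
  ones (map f (weighted (s ∷ ss))) ≡ toℕ (f s) ℕ.+ 2 ℕ.* ones (map f (weighted ss))
ones-weighted f s ss = begin
  ones (f s ∷ map f (ws ++ ws))          ≡⟨ head (f s) ⟩
  toℕ (f s) ℕ.+ ones (map f (ws ++ ws))  ≡⟨ cong (toℕ (f s) ℕ.+_) double ⟩
  toℕ (f s) ℕ.+ 2 ℕ.* ones (map f ws)    ∎
  where
  open ≡-Reasoning
  ws = weighted ss
  head : ∀ a {w} → ones (a ∷ w) ≡ toℕ a ℕ.+ ones w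
  head zero = refl
  head (suc zero) = refl
  double : ones (map f (ws ++ ws)) ≡ 2 ℕ.* ones (map f ws)
  double = trans (cong ones (List.map-++ f ws ws)) (trans (ones-++ (map f ws) (map f ws))
    (cong (ones (map f ws) ℕ.+_) (sym (ℕ.+-identityʳ _))))

binary-injective : ∀ (a b : Fin 2) {m n} → toℕ a ℕ.+ 2 ℕ.* m ≡ toℕ b ℕ.+ 2 ℕ.* n → a ≡ b × m ≡ n
binary-injective zero zero eq = refl , ℕ.*-cancelˡ-≡ _ _ 2 eq
binary-injective zero (suc zero) {m} {n} eq = contradiction eq (ℕ.even≢odd m n)
binary-injective (suc zero) zero {m} {n} eq = contradiction (sym eq) (ℕ.even≢odd n m)
binary-injective (suc zero) (suc zero) eq = refl , ℕ.*-cancelˡ-≡ _ _ 2 (ℕ.suc-injective eq)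

-- By `ones-weighted`, the two counts are binary numerals whose digits are the letters, the head
-- being the lowest digit. Parity recovers that digit, and halving leaves the numerals of the tails.
weighted-separates : (f g : ℤ² → Fin 2) → ∀ ss →
  ones (map f (weighted ss)) ≡ ones (map g (weighted ss)) → map f ss ≡ map g ss
weighted-separates f g [] _ = refl
weighted-separates f g (s ∷ ss) eq
  with binary-injective (f s) (g s) (trans (sym (ones-weighted f s ss)) (trans eq (ones-weighted g s ss)))
... | fs≡gs , eq′ = cong₂ _∷_ fs≡gs (weighted-separates f g ss eq′)

map-≡⇒≡ : {A C : Set} {f g : A → C} {xs : List A} → map f xs ≡ map g xs → ∀ {a} → a ∈ xs → f a ≡ g a
map-≡⇒≡ eq (here refl) = List.∷-injectiveˡ eq
map-≡⇒≡ eq (there a∈xs) = map-≡⇒≡ (List.∷-injectiveʳ eq) a∈xs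

-- Periods on a segment.

n∣m! : ∀ {m n} → 0 ℕ.< n → n ≤ m → n ∣ m !
n∣m! {n = suc n} _ n<m = ∣-trans (m∣m*n (n !)) (m≤n⇒m!∣n! n<m)

-- The steps start at `0`, `d`, ..., `(q - 1) d`, all at most `K`, so the period is applied only
-- where it is known to hold.
iterate-localPeriod : {A : Set} (y : ℕ → A) (d : ℕ) {K : ℕ} → (∀ n → n ≤ K → y (n ℕ.+ d) ≡ y n) →
  ∀ q → q ℕ.* d ≤ K → y (q ℕ.* d) ≡ y 0
iterate-localPeriod y d per zero _ = refl
iterate-localPeriod y d {K} per (suc q) q*d≤K = begin
  y (d ℕ.+ q ℕ.* d)  ≡⟨ cong y (ℕ.+-comm d (q ℕ.* d)) ⟩
  y (q ℕ.* d ℕ.+ d)  ≡⟨ per (q ℕ.* d) q*d≤K′ ⟩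
  y (q ℕ.* d)        ≡⟨ iterate-localPeriod y d per q q*d≤K′ ⟩
  y 0                ∎
  where
  open ≡-Reasoning
  q*d≤K′ : q ℕ.* d ≤ K
  q*d≤K′ = ℕ.≤-trans (ℕ.m≤n+m _ d) q*d≤K

shift-back : ∀ i n z e → (ℤ.- + i) ·² e +² (z +² + (i ℕ.+ n) ·² e) ≡ z +² + n ·² e
shift-back i n (z₁ , z₂) (a , b) = cong₂ _,_ (eq (+ i) (+ n) z₁ a) (eq (+ i) (+ n) z₂ b)
  where
  eq : ∀ i n z a → (ℤ.- i) ℤ.* a ℤ.+ (z ℤ.+ (i ℤ.+ n) ℤ.* a) ≡ z ℤ.+ n ℤ.* a
  eq = solve-∀

-- Recurrence and bounded complexity yield periods.

module _ (x : Config) where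

  IsReturn : List ℤ² → ℤ² → Set
  IsReturn zs u = All (λ z → x (z +² u) ≡ x z) zs

  Recurrent : Set
  Recurrent = ∀ zs → ∃[ u ] (u ≢ 0² × IsReturn zs u)

  stronglyRecurrent⇒recurrent : StronglyRecurrent x → Recurrent
  stronglyRecurrent⇒recurrent (_ , _ , returns) zs with bounded zs
  -- Box sizes start at 1, while `bounded` may return 0; hence `suc N`.
  ... | N , zs≤N with returns (suc N) (s≤s z≤n)
  ... | u , _ , u≢0 , _ , returning , _ =
    u , u≢0 , All.map (λ {z} z≤N → proj₁ (returning z (∈Box z (ℕ.m≤n⇒m≤1+n z≤N)))) zs≤N

  word : ℤ² → List ℤ² → List (Fin 2)
  word t = map (λ s → x (t +² s))

  BoundedAbelianComplexity : ℕ → Set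
  BoundedAbelianComplexity B = sup {I = Σ[ k ∈ ℕ ] 1 ≤ k} (λ (k , _) → p*-ab x k) B

  module _ (recurrent : Recurrent) where

    -- If `u` is a return for `zs` and `v` one for all sums `z + u`, then `u + v` is again a return
    -- for `zs`. `leaves` picks a `u` for which this sum is new.
    manyReturns : ∀ zs n → ∃[ us ] (length us ≡ suc n × Unique us × All (IsReturn zs) us)
    manyReturns zs zero =
      -- The trivial return starts the list, since `leaves` needs a member to work from.
      0² ∷ [] , refl , [] ∷ [] , All.universal (λ z → cong x (+²-identityʳ z)) zs ∷ []
    manyReturns zs (suc n) with manyReturns zs n
    ... | us@(_ ∷ _) , len , us! , returns with recurrent (cartesianProductWith _+²_ zs us)
    ... | v , v≢0 , v-return with leaves v≢0 (here refl)
    ... | u , u∈us , u+v∉us =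
      u +² v ∷ us , cong suc len , ¬Any⇒All¬ us u+v∉us ∷ us! , All.tabulate new ∷ returns
      where
      new : ∀ {z} → z ∈ zs → x (z +² (u +² v)) ≡ x z
      new {z} z∈zs = begin
        x (z +² (u +² v))  ≡⟨ cong x (+²-assoc z u v) ⟨
        x (z +² u +² v)    ≡⟨ All.lookup v-return (∈-cartesianProductWith⁺ _+²_ z∈zs u∈us) ⟩
        x (z +² u)         ≡⟨ All.lookup (All.lookup returns u∈us) z∈zs ⟩
        x z                ∎
        where open ≡-Reasoning

    -- A return `u` for the points `t + s` makes `s + u` a copy of `s`. Among `suc (length ys)`
    -- distinct returns, some `s + u` falls outside `ys`.
    freshCopy : ∀ ts s ys → ∃[ s′ ] (s′ ∉ ys × All (λ t → x (t +² s′) ≡ x (t +² s)) ts)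
    freshCopy ts s ys with manyReturns (map (_+² s) ts) (length ys)
    ... | us , len , us! , returns with Any.any? (λ u → s +² u ∉? ys) us
    ... | yes some with find some
    ... | u , u∈us , s+u∉ys = s +² u , s+u∉ys ,
      All.map (λ {t} eq → trans (cong x (sym (+²-assoc t s u))) eq) (map⁻ (All.lookup returns u∈us))
    freshCopy ts s ys | us , len , us! , returns | no none =
      contradiction (subst (_≤ length ys) (trans (List.length-map (s +²_) us) len)
        (Unique-⊆⇒length≤ (Unique.map⁺ (+²-cancelˡ s) us!)
          (map⁺ (All.map (λ {u} → decidable-stable ((s +² u) ∈? ys)) (¬Any⇒All¬ us none)))))
        ℕ.1+n≰n

    -- Working from the tail, each point is exchanged for a fresh copy avoiding those already
    -- chosen. This turns the repetitions of `weighted` into a genuine finite subset.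
    uniquify : ∀ ts ms → ∃[ ys ] (Unique ys × length ys ≡ length ms ×
      All (λ t → word t ys ≡ word t ms) ts)
    uniquify ts [] = [] , [] , refl , All.universal (λ _ → refl) ts
    uniquify ts (s ∷ ms) with uniquify ts ms
    ... | ys , ys! , len , same with freshCopy ts s ys
    ... | s′ , s′∉ys , copy = s′ ∷ ys , ¬Any⇒All¬ ys s′∉ys ∷ ys! , cong suc len ,
      All.zipWith (λ (p , q) → cong₂ _∷_ p q) (copy , same)

    -- If the words were pairwise distinct, so would be their binary codes. These codes are the
    -- counts of ones over the repetition-free `ys`, so `suc B` translates would be pairwise Abelian
    -- inequivalent there.
    collision : ∀ {B} → BoundedAbelianComplexity B → (t : Fin (suc B) → ℤ²) → ∀ s ss →
      ∃[ i ] ∃[ j ] (i Fin.< j × word (t i) (s ∷ ss) ≡ word (t j) (s ∷ ss))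
    collision bound t s ss
      with Fin.any? (λ i → Fin.any? (λ j → i Fin.<? j ×-dec
             List.≡-dec Fin._≟_ (word (t i) (s ∷ ss)) (word (t j) (s ∷ ss))))
    ... | yes found = found
    ... | no none with uniquify (tabulate t) (weighted (s ∷ ss))
    ... | ys , ys! , len , same = contradiction
      -- As `s ∷ ss` is nonempty, so is `ys`, and its size lies in the range `1 ≤ k` of the
      -- supremum.
      (bound (length ys , subst (1 ≤_) (sym len) (s≤s z≤n)) (finiteSubset ys ys! , refl) t injective)
      ℕ.1+n≰n
      where
      equalWords : ∀ i j → AbelianEquivalent (word (t i) ys) (word (t j) ys) →
        word (t i) (s ∷ ss) ≡ word (t j) (s ∷ ss)
      equalWords i j equiv = weighted-separates _ _ (s ∷ ss)
        (trans (cong ones (sym (All.lookup same (∈-tabulate⁺ {f = t} i))))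
          (trans (equiv (suc zero)) (cong ones (All.lookup same (∈-tabulate⁺ {f = t} j)))))
      injective : ∀ {i j} → AbelianEquivalent (word (t i) ys) (word (t j) ys) → i ≡ j
      injective {i} {j} equiv with Fin.<-cmp i j
      ... | tri< i<j _ _ = contradiction (i , j , i<j , equalWords i j equiv) none
      ... | tri≈ _ i≡j _ = i≡j
      ... | tri> _ _ j<i = contradiction (j , i , j<i , sym (equalWords i j equiv)) none

    -- Among the B + 1 translates by -i e, two agree on a long segment z + m e, which gives a
    -- local period d e with 1 ≤ d ≤ B; passing to B ! makes the period independent of z.
    factorialPeriod : ∀ {B} → BoundedAbelianComplexity B → ∀ e → IsPeriod x (+ (B !) ·² e)
    factorialPeriod {B} bound e z
      -- The segment runs from `point 0` to `point (B ! + B)`: it must contain every index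
      -- `toℕ j + n` with `toℕ j ≤ B` and `n ≤ B !`.
      with collision bound (λ i → (ℤ.- + toℕ i) ·² e) (point 0) (map point (applyUpTo suc (B ! ℕ.+ B)))
      where
      point : ℕ → ℤ²
      point m = z +² + m ·² e
    ... | i , j , i<j , equal = begin
      y (B !)      ≡⟨ cong y B!≡q*d ⟩
      y (q ℕ.* d)  ≡⟨ iterate-localPeriod y d localPeriod q (ℕ.≤-reflexive (sym B!≡q*d)) ⟩
      y 0          ≡⟨ cong (λ v → x (z +² v)) (·²-zeroˡ e) ⟩
      x (z +² 0²)  ≡⟨ cong x (+²-identityʳ z) ⟩
      x z          ∎
      where
      open ≡-Reasoning
      y : ℕ → Fin 2
      y n = x (z +² + n ·² e)
      d : ℕ
      d = toℕ j ℕ.∸ toℕ i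
      j≤B : toℕ j ≤ B
      j≤B = ℕ.s≤s⁻¹ (Fin.toℕ<n j)
      d∣B! : d ∣ B !
      d∣B! = n∣m! (ℕ.m<n⇒0<n∸m i<j) (ℕ.≤-trans (ℕ.m∸n≤m _ (toℕ i)) j≤B)
      q : ℕ
      q = _∣_.quotient d∣B!
      B!≡q*d : B ! ≡ q ℕ.* d
      B!≡q*d = _∣_.equality d∣B!
      index≡ : ∀ n → toℕ i ℕ.+ (n ℕ.+ d) ≡ toℕ j ℕ.+ n
      index≡ n = begin
        toℕ i ℕ.+ (n ℕ.+ d)  ≡⟨ cong (toℕ i ℕ.+_) (ℕ.+-comm n d) ⟩
        toℕ i ℕ.+ (d ℕ.+ n)  ≡⟨ ℕ.+-assoc (toℕ i) d n ⟨
        toℕ i ℕ.+ d ℕ.+ n    ≡⟨ cong (ℕ._+ n) (ℕ.m+[n∸m]≡n (ℕ.<⇒≤ i<j)) ⟩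
        toℕ j ℕ.+ n          ∎
      -- The point with index `toℕ j + n` shows `y (n + d)` from the `i`-th translate and `y n` from
      -- the `j`-th, and the two words agree at it.
      localPeriod : ∀ n → n ≤ B ! → y (n ℕ.+ d) ≡ y n
      localPeriod n n≤B! = begin
        y (n ℕ.+ d)
          ≡⟨ cong x (shift-back (toℕ i) (n ℕ.+ d) z e) ⟨
        x ((ℤ.- + toℕ i) ·² e +² (z +² + (toℕ i ℕ.+ (n ℕ.+ d)) ·² e))
          ≡⟨ cong (λ m → x ((ℤ.- + toℕ i) ·² e +² (z +² + m ·² e))) (index≡ n) ⟩
        x ((ℤ.- + toℕ i) ·² e +² (z +² + (toℕ j ℕ.+ n) ·² e))
          ≡⟨ map-≡⇒≡ equal (∈-map⁺ (λ m → z +² + m ·² e) (∈-upTo⁺ (s≤s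
               (subst (_≤ B ! ℕ.+ B) (ℕ.+-comm n (toℕ j)) (ℕ.+-mono-≤ n≤B! j≤B))))) ⟩
        x ((ℤ.- + toℕ j) ·² e +² (z +² + (toℕ j ℕ.+ n) ·² e))
          ≡⟨ cong x (shift-back (toℕ j) n z e) ⟩
        y n ∎

    bounded⇒doublyPeriodic : ∀ {B} → BoundedAbelianComplexity B → DoublyPeriodic x
    bounded⇒doublyPeriodic {B} bound =
      + (B !) ·² (1ℤ , 0ℤ) , + (B !) ·² (0ℤ , 1ℤ) , independent ,
      factorialPeriod bound (1ℤ , 0ℤ) , factorialPeriod bound (0ℤ , 1ℤ)
      where
      first : ∀ m n c → m ℤ.* (c ℤ.* 1ℤ) ℤ.+ n ℤ.* (c ℤ.* 0ℤ) ≡ m ℤ.* c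
      first = solve-∀
      second : ∀ m n c → m ℤ.* (c ℤ.* 0ℤ) ℤ.+ n ℤ.* (c ℤ.* 1ℤ) ≡ n ℤ.* c
      second = solve-∀
      cancel : ∀ m → m ℤ.* + (B !) ≡ 0ℤ → m ≡ 0ℤ
      cancel m eq = ℤ.*-cancelʳ-≡ m 0ℤ (+ (B !)) {{B ℕ.!≢0}} eq
      independent : LinearlyIndependent (+ (B !) ·² (1ℤ , 0ℤ)) (+ (B !) ·² (0ℤ , 1ℤ))
      independent m n eq =
        cancel m (trans (sym (first m n (+ (B !)))) (cong proj₁ eq)) ,
        cancel n (trans (sym (second m n (+ (B !)))) (cong proj₂ eq))

  -- Two independent periods bound the number of factors.

  isPeriod-+² : ∀ {p q} → IsPeriod x p → IsPeriod x q → IsPeriod x (p +² q)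
  isPeriod-+² {p} {q} perₚ per-q t = trans (cong x (sym (+²-assoc t p q))) (trans (per-q (t +² p)) (perₚ t))

  isPeriod-+·² : ∀ {p} → IsPeriod x p → ∀ n → IsPeriod x (+ n ·² p)
  isPeriod-+·² {p} per zero t = cong x (trans (cong (t +²_) (·²-zeroˡ p)) (+²-identityʳ t))
  isPeriod-+·² {p} per (suc n) =
    subst (IsPeriod x) (sym (·²-suc (+ n) p)) (isPeriod-+² (isPeriod-+·² per n) per)

  isPeriod-·² : ∀ {p} → IsPeriod x p → ∀ n → IsPeriod x (n ·² p)
  isPeriod-·² per (+ n) = isPeriod-+·² per n
  isPeriod-·² {p} per -[1+ n ] t = begin
    -- The positive multiple is a period; applied at the shifted point, it leads back to `t`.
    x (t +² -[1+ n ] ·² p)                    ≡⟨ isPeriod-+·² per (suc n) (t +² -[1+ n ] ·² p) ⟨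
    x (t +² -[1+ n ] ·² p +² + suc n ·² p)    ≡⟨ cong x (cancel t p) ⟩
    x t                                       ∎
    where
    open ≡-Reasoning
    cancel₁ : ∀ t n a → t ℤ.+ (ℤ.- n) ℤ.* a ℤ.+ n ℤ.* a ≡ t
    cancel₁ = solve-∀
    cancel : ∀ t p → t +² -[1+ n ] ·² p +² + suc n ·² p ≡ t
    cancel (t₁ , t₂) (a , b) = cong₂ _,_ (cancel₁ t₁ (+ suc n) a) (cancel₁ t₂ (+ suc n) b)

  -- The adjugate of the matrix with rows `p` and `q`, times that matrix, is `D` times the identity.
  -- Its rows `(d , - b)` and `(- c , a)` are thus the coefficients of the two axis periods.
  axisPeriods : DoublyPeriodic x →
    ∃[ D ] (D ≢ 0ℤ × IsPeriod x (D , 0ℤ) × IsPeriod x (0ℤ , D))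
  axisPeriods (p@(a , b) , q@(c , d) , independent , perₚ , per-q) =
    D , D≢0 ,
    subst (IsPeriod x) first (isPeriod-+² (isPeriod-·² perₚ d) (isPeriod-·² per-q (ℤ.- b))) ,
    subst (IsPeriod x) second (isPeriod-+² (isPeriod-·² perₚ (ℤ.- c)) (isPeriod-·² per-q a))
    where
    D = d ℤ.* a ℤ.+ ℤ.- b ℤ.* c
    vanish : ∀ d b → d ℤ.* b ℤ.+ ℤ.- b ℤ.* d ≡ 0ℤ
    vanish = solve-∀
    vanish′ : ∀ a c → ℤ.- c ℤ.* a ℤ.+ a ℤ.* c ≡ 0ℤ
    vanish′ = solve-∀
    swap : ∀ a b c d → ℤ.- c ℤ.* b ℤ.+ a ℤ.* d ≡ d ℤ.* a ℤ.+ ℤ.- b ℤ.* c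
    swap = solve-∀
    first : d ·² p +² (ℤ.- b) ·² q ≡ (D , 0ℤ)
    first = cong (D ,_) (vanish d b)
    second : (ℤ.- c) ·² p +² a ·² q ≡ (0ℤ , D)
    second = cong₂ _,_ (vanish′ a c) (swap a b c d)
    D≢0 : D ≢ 0ℤ
    -- If `D` vanished, both combinations would be zero, so independence would force `a`, `b`, `c`,
    -- `d` to be 0; but then `1 p + 0 q` is a nontrivial relation.
    D≢0 D≡0
      with independent d (ℤ.- b) (trans first (cong (_, 0ℤ) D≡0))
         | independent (ℤ.- c) a (trans second (cong (0ℤ ,_) D≡0))
    ... | refl , -b≡0 | -c≡0 , refl with ℤ.neg-injective {b} {0ℤ} -b≡0 | ℤ.neg-injective {c} {0ℤ} -c≡0
    ... | refl | refl with independent 1ℤ 0ℤ refl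
    ... | () , _

  module _ (D : ℤ) .{{_ : ℤ.NonZero D}} (per₁ : IsPeriod x (D , 0ℤ)) (per₂ : IsPeriod x (0ℤ , D)) where

    residue : ℤ → Fin ℤ.∣ D ∣
    residue i = fromℕ< (ℤ.n%d<d i D)

    reduce : ∀ i j s → x ((i , j) +² s) ≡ x ((+ toℕ (residue i) , + toℕ (residue j)) +² s)
    reduce i j (s₁ , s₂) = begin
      x (i ℤ.+ s₁ , j ℤ.+ s₂)  ≡⟨ cong x (cong₂ _,_ (eq₁ i s₁) (eq₂ j s₂)) ⟩
      x ((r i ℤ.+ s₁ , r j ℤ.+ s₂) +² (i ℤ./ D ·² (D , 0ℤ) +² j ℤ./ D ·² (0ℤ , D)))
        ≡⟨ isPeriod-+² (isPeriod-·² per₁ (i ℤ./ D)) (isPeriod-·² per₂ (j ℤ./ D)) _ ⟩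
      x (r i ℤ.+ s₁ , r j ℤ.+ s₂) ∎
      where
      open ≡-Reasoning
      r : ℤ → ℤ
      r i = + toℕ (residue i)
      division : ∀ i → i ≡ r i ℤ.+ i ℤ./ D ℤ.* D
      division i = trans (ℤ.a≡a%n+[a/n]*n i D)
        (cong (λ m → + m ℤ.+ i ℤ./ D ℤ.* D) (sym (Fin.toℕ-fromℕ< (ℤ.n%d<d i D))))
      -- The terms `l * 0` come from the zero coordinate of the other axis period.
      regroup₁ : ∀ r k D s l → r ℤ.+ k ℤ.* D ℤ.+ s ≡ r ℤ.+ s ℤ.+ (k ℤ.* D ℤ.+ l ℤ.* 0ℤ)
      regroup₁ = solve-∀
      regroup₂ : ∀ r k D s l → r ℤ.+ k ℤ.* D ℤ.+ s ≡ r ℤ.+ s ℤ.+ (l ℤ.* 0ℤ ℤ.+ k ℤ.* D)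
      regroup₂ = solve-∀
      eq₁ : ∀ i s → i ℤ.+ s ≡ r i ℤ.+ s ℤ.+ (i ℤ./ D ℤ.* D ℤ.+ j ℤ./ D ℤ.* 0ℤ)
      eq₁ i′ s = trans (cong (ℤ._+ s) (division i′)) (regroup₁ (r i′) (i′ ℤ./ D) D s (j ℤ./ D))
      eq₂ : ∀ j s → j ℤ.+ s ≡ r j ℤ.+ s ℤ.+ (i ℤ./ D ℤ.* 0ℤ ℤ.+ j ℤ./ D ℤ.* D)
      eq₂ j′ s = trans (cong (ℤ._+ s) (division j′)) (regroup₂ (r j′) (j′ ℤ./ D) D s (i ℤ./ D))

    -- By `reduce`, the factor at a translate depends only on its coordinates modulo `D`.
    -- Inequivalent translates therefore have distinct residue pairs, whatever `S` is.
    axisPeriods⇒bounded : BoundedAbelianComplexity (ℤ.∣ D ∣ ℕ.* ℤ.∣ D ∣)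
    axisPeriods⇒bounded _ (S , _) f f-injective = Fin.injective⇒≤ {f = class ∘ f}
      λ {i} {j} eq → f-injective λ a → cong (occurrences a) (sameFactor (f i) (f j) eq)
      where
      class : ℤ² → Fin (ℤ.∣ D ∣ ℕ.* ℤ.∣ D ∣)
      class (i , j) = combine (residue i) (residue j)
      sameFactor : ∀ t t′ → class t ≡ class t′ → factor x S t ≡ factor x S t′
      sameFactor (i , j) (i′ , j′) eq
        with Fin.combine-injective (residue i) (residue j) (residue i′) (residue j′) eq
      ... | eq₁ , eq₂ = List.map-cong (λ s → trans (reduce i j s)
        (trans (cong₂ (λ k l → x ((+ toℕ k , + toℕ l) +² s)) eq₁ eq₂) (sym (reduce i′ j′ s)))) (elements S)

theorem1p7 : (x : Config) → StronglyRecurrent x →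
    DoublyPeriodic x ⇔ Finite (sup {I = Σ[ k ∈ ℕ ] 1 ≤ k} (λ (k , _) → p*-ab x k))
theorem1p7 x stronglyRecurrent = mk⇔
  (λ doublyPeriodic → case axisPeriods x doublyPeriodic of λ
    (D , D≢0 , per₁ , per₂) → _ , axisPeriods⇒bounded x D {{ℤ.≢-nonZero D≢0}} per₁ per₂)
  (λ (_ , bound) →
    bounded⇒doublyPeriodic x (stronglyRecurrent⇒recurrent x stronglyRecurrent) bound)
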